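{- Under the exact slab decomposition and no arithmetic recomputation, PACO's two local FFT phases satisfy $$Q_{\max}=\Omega\!\left(\frac{N}{pB}\bigl(1+\log_M N\bigr)\right).$$ Consequently, the complete PACO execution satisfies the same lower bound.
   Context: $b=2^t=O(1)$ is a fixed radix, $N=N_1N_2$ with $N_1,N_2$ powers of $b$; $p\ge2$ processors, $p$ a power of $b$ with $p\mid N_1$ and $p\mid N_2$ (exact slab decomposition). Each processor has a private fully associative ideal cache of $M\ge2$ items, block size $B$, optimal replacement, initially empty; $M=\Omega(B^2)$, $N_1/p\ge B$, $N_2/p\ge B$ are standing assumptions. A PACO execution consists, on each processor, of Phase I: evaluating $N_2/p$ data-disjoint length-$N_1$ FFT DAGs; a middle redistribution stage; and Phase III: evaluating $N_1/p$ data-disjoint length-$N_2$ FFT DAGs. Phases are executed sequentially, Phase I starting with an empty cache. An FFT DAG here is the fixed-radix Cooley–Tukey DAG with each radix-$b$ butterfly expanded into radix-2 layers, i.e. the standard radix-2 FFT DAG: for length $n=2^r$ it has levels $0,\dots,r$ of $n$ vertices, level $0$ being the inputs, and vertex $i$ at level $l+1$ has as predecessors vertices $i$ and $i\oplus2^l$ at level $l$. No recomputation: every noninput vertex is evaluated exactly once, in an arbitrary order respecting dependencies; evaluating a vertex requires its predecessors' values to be in cache, and each cache miss loads one block of at most $B$ items. $Q_{\max}$ is the maximum over processors of the number of cache misses (in the two local phases, respectively in the complete execution). -}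

module Defs where

open import Data.Bool.Base using (Bool; not)
open import Data.Fin.Base using (Fin; zero; suc; inject₁)
open import Data.List.Base using (List; []; _∷_; _++_; length; map)
open import Data.List.Membership.Propositional using (_∈_; _∉_)
open import Data.List.Relation.Binary.Subset.Propositional using (_⊆_)
open import Data.List.Relation.Unary.All using (All)
open import Data.Nat.Base using (ℕ; zero; suc; _+_; _*_; _^_; _≤_; _⊔_)
open import Data.Nat.Divisibility using (_∣_; quotient)
open import Data.Nat.Properties using (^-*-assoc)
open import Data.Product.Base using (_×_; _,_; proj₁; proj₂)
open import Data.Sum.Base using (_⊎_)
open import Data.Vec.Base using (Vec; _[_]%=_)
import Data.Vec.Functional as Vector
open import Relation.Binary.PropositionalEquality using (_≡_)
open import Relation.Nullary using (¬_)

record DAG : Set₁ where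
  field
    Vertex : Set
    preds  : Vertex → List Vertex

  Input : Vertex → Set
  Input v = preds v ≡ []

-- The radix-2 FFT DAG of length 2 ^ r.  A vertex is a level in 0 … r together
-- with an index below 2 ^ r, written in binary with bit l at position l; so
-- i [ l ]%= not  is  i ⊕ 2 ^ l.
FFT : ℕ → DAG
FFT r = record { Vertex = Fin (suc r) × Vec Bool r ; preds = preds }
  where
  preds : Fin (suc r) × Vec Bool r → List (Fin (suc r) × Vec Bool r)
  preds (zero  , i) = []
  preds (suc l , i) = (inject₁ l , i) ∷ (inject₁ l , i [ l ]%= not) ∷ []

-- k disjoint copies of G.
copies : ℕ → DAG → DAG
copies k G = record
  { Vertex = Fin k × Vertex
  ; preds  = λ (j , v) → map (j ,_) (preds v)
  }
  where open DAG G

module Cache (M B : ℕ) (G : DAG) where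
  open DAG G

  -- The cached values, and the noninput vertices evaluated so far.
  State : Set
  State = List Vertex × List Vertex

  cache : State → List Vertex
  cache = proj₁

  evaluated : State → List Vertex
  evaluated = proj₂

  -- Inputs reside in memory from the start; a computed value can be reloaded
  -- after it has been evicted.
  Available : List Vertex → Vertex → Set
  Available E v = Input v ⊎ v ∈ E

  -- Run s q s′: an evaluation from s to s′ with q cache misses.  The inclusions
  -- let every step evict any values at all, so that every replacement policy,
  -- in particular the optimal one, is covered.  Evaluation may overwrite a
  -- predecessor: only the resulting cache C′ has to fit into M items.
  data Run : State → ℕ → State → Set where
    stop : ∀ {s} → Run s 0 s

    miss : ∀ {C C′ E q s} (block : List Vertex) →
           length block ≤ B →
           All (Available E) block →
           C′ ⊆ block ++ C →
           length C′ ≤ M →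
           Run (C′ , E) q s →
           Run (C , E) (suc q) s

    eval : ∀ {C C′ E q s} (v : Vertex) →
           ¬ Input v →
           v ∉ E →
           All (_∈ C) (preds v) →
           C′ ⊆ v ∷ C →
           length C′ ≤ M →
           Run (C′ , v ∷ E) q s →
           Run (C , E) q s

  -- A complete evaluation of G from the initial cache C₀; since a run never
  -- repeats a vertex, every noninput vertex is evaluated exactly once.
  record Evaluation (C₀ : List Vertex) : Set where
    field
      misses   : ℕ
      final    : State
      run      : Run (C₀ , []) misses final
      complete : ∀ v → ¬ Input v → v ∈ evaluated final

-- The radix is b = 2 ^ t, and M = Ω(B²) is B * B ≤ K * M.
record Parameters (t K : ℕ) : Set where
  b : ℕ
  b = 2 ^ t

  field
    n₁ n₂ e M B : ℕ

  N₁ : ℕ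
  N₁ = b ^ n₁

  N₂ : ℕ
  N₂ = b ^ n₂

  N : ℕ
  N = N₁ * N₂

  p : ℕ
  p = b ^ e

  field
    2≤p    : 2 ≤ p
    p∣N₁   : p ∣ N₁
    p∣N₂   : p ∣ N₂
    2≤M    : 2 ≤ M
    1≤B    : 1 ≤ B
    B²≤KM  : B * B ≤ K * M
    B≤N₁/p : B ≤ quotient p∣N₁
    B≤N₂/p : B ≤ quotient p∣N₂

  r₁ r₂ : ℕ
  r₁ = t * n₁
  r₂ = t * n₂

  N₁≡2^r₁ : N₁ ≡ 2 ^ r₁
  N₁≡2^r₁ = ^-*-assoc 2 t n₁

  N₂≡2^r₂ : N₂ ≡ 2 ^ r₂
  N₂≡2^r₂ = ^-*-assoc 2 t n₂

  dagI dagIII : DAG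
  dagI   = copies (quotient p∣N₂) (FFT r₁)
  dagIII = copies (quotient p∣N₁) (FFT r₂)

  -- The redistribution stage is arbitrary: any number of misses, after which
  -- any Phase III inputs that fit may already be cached.  No other Phase III
  -- value exists at that point, and values foreign to Phase III would only
  -- occupy space.
  record LocalExecution : Set where
    field
      phaseI            : Cache.Evaluation M B dagI []
      middleMisses      : ℕ
      cacheIII          : List (DAG.Vertex dagIII)
      cacheIII-inputs   : All (DAG.Input dagIII) cacheIII
      length-cacheIII≤M : length cacheIII ≤ M
      phaseIII          : Cache.Evaluation M B dagIII cacheIII

    missesI missesIII localMisses totalMisses : ℕ
    missesI     = Cache.Evaluation.misses phaseI
    missesIII   = Cache.Evaluation.misses phaseIII
    localMisses = missesI + missesIII
    totalMisses = missesI + middleMisses + missesIII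

  Execution : Set
  Execution = Fin p → LocalExecution

  maximum : (Fin p → ℕ) → ℕ
  maximum = Vector.foldr _⊔_ 0

  Qmax-local Qmax-complete : Execution → ℕ
  Qmax-local    X = maximum λ i → LocalExecution.localMisses (X i)
  Qmax-complete X = maximum λ i → LocalExecution.totalMisses (X i)

  -- N / (p B) · (1 + log_M N) ≤ C · Q, that is  N + N log_M N ≤ C Q p B,
  -- with both sides taken as exponents of M ≥ 2.
  LowerBound : (C Q : ℕ) → Set
  LowerBound C Q = M ^ N * N ^ N ≤ M ^ (C * Q * (p * B))

{-# OPTIONS --safe #-}
module Submission where

-- Every value evaluated during a stretch of a run is derivable, with unlimited
-- room, from the set D of values cached at its start or loaded during it
-- (dominate).  An FFT DAG has small span: the derivable vertices of D number at
-- most S log (2 S), where S = |D| (FFT-boundedSpan).  The two halves above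
-- level 0 are smaller FFT DAGs; their level-1 vertices arise from pairs of level-0
-- vertices that both lie in D, and each such pair adds one vertex to either half.
-- Hence the bound follows by induction from
-- 2 p + a log (2 a) + b log (2 b) ≤ (a + b) log (2 (a + b)) for p ≤ a , b, which is
-- 4 a b ≤ (a + b) ² in exponential form (spanBound-step).  Logarithms are avoided
-- throughout by comparing powers.  Disjoint copies obey the same bound.
--
-- A run with q misses is cut into q / m + 1 stretches of at most m = M / B + 1
-- misses each.  Each has |D| ≤ M + m B ≤ (2 + K) M, as B ≤ B ² ≤ K M, so it
-- evaluates O(M log M) vertices.  Since M ≤ m B, a phase with q misses evaluates
-- O((M + q B) log M) vertices in total (phase-bound).  With n = N / p, the two
-- phases together evaluate n log N vertices, so with Q = missesI + missesIII,
-- n log N = O((M + Q B) log M) (N^n-bound).  Phase I starts from an empty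
-- cache and must load each of its n inputs, so n ≤ Q B (inputs-bound).  If
-- M ≤ n, the summand M is absorbed into Q B; if n ≤ M, then N ≤ n ² ≤ M ², because
-- p ≤ n, and n log N ≤ 2 n log M ≤ 2 Q B log M directly (combine).

open import Defs
open import Data.Bool.Base using (Bool; true; false)
open import Data.Fin.Base using (Fin; zero; suc; fromℕ<)
open import Data.Fin.Properties using (injective⇒≤)
open import Data.List.Base using (List; []; _∷_; _++_; length; map; mapMaybe;
  lookup; allFin; cartesianProduct; cartesianProductWith)
open import Data.List.Properties using (++-assoc; ++-identityʳ; length-map;
  length-++; length-tabulate)
open import Data.List.Membership.Propositional using (_∈_)
open import Data.List.Membership.Propositional.Properties
  using (∈-map⁺; ∈-map⁻; ∈-++⁺ˡ; ∈-++⁺ʳ; ∈-++⁻; ∈-lookup)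
open import Data.List.Relation.Binary.Subset.Propositional using (_⊆_)
import Data.List.Relation.Unary.All as All
open import Data.List.Relation.Unary.AllPairs using ([]; _∷_)
open import Data.List.Relation.Unary.Any using (here; there; index)
open import Data.List.Relation.Unary.Any.Properties using (lookup-index)
open import Data.List.Relation.Unary.Unique.Propositional using (Unique)
open import Data.List.Relation.Unary.Unique.Propositional.Properties
  using (map⁺; allFin⁺; cartesianProduct⁺; cartesianProductWith⁺)
open import Data.Maybe.Base using (Maybe; just; nothing)
open import Data.Nat.Base
open import Data.Nat.Divisibility using (quotient; m∣n⇒n≡quotient*m; ∣⇒≤)
open import Data.Nat.DivMod using (_/_; _%_; m≡m%n+[m/n]*n; m%n<n; m/n*n≤m)
open import Data.Nat.Properties
open import Data.Nat.Tactic.RingSolver using (solve-∀)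
open import Data.Product.Base using (∃-syntax; _×_; _,_; proj₁; proj₂)
open import Data.Sum.Base using (_⊎_; inj₁; inj₂; map₂)
open import Data.Vec.Base using (Vec; []; _∷_)
open import Data.Vec.Functional using (foldr)
open import Data.Vec.Properties using (∷-injective)
open import Relation.Binary.PropositionalEquality
open import Relation.Nullary using (¬_; contradiction)

-- Powers in place of logarithms

^-distribʳ-* : ∀ m n o → (m * n) ^ o ≡ m ^ o * n ^ o
^-distribʳ-* m n zero    = refl
^-distribʳ-* m n (suc o) =
  trans (cong (m * n *_) (^-distribʳ-* m n o)) (shuffle m n (m ^ o) (n ^ o))
  where
  shuffle : ∀ a b x y → a * b * (x * y) ≡ a * x * (b * y)
  shuffle = solve-∀

-- 2 to the power s log (2 s), where s log (2 s) bounds the number of vertices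
-- derivable from s given ones.  In particular spanBound 0 ≡ 1.
spanBound : ℕ → ℕ
spanBound s = (2 * s) ^ s

private
  spanBound-step-≤ : ∀ p a d → p ≤ a →
    2 ^ (p + p) * (spanBound a * spanBound (a + d)) ≤ spanBound (a + (a + d))
  spanBound-step-≤ p a d p≤a = begin
    2 ^ (p + p) * (x ^ a * y ^ (a + d))
      ≤⟨ *-monoˡ-≤ (x ^ a * y ^ (a + d)) (^-monoʳ-≤ 2 (+-mono-≤ p≤a p≤a)) ⟩
    2 ^ (a + a) * (x ^ a * y ^ (a + d))
      ≡⟨ cong₂ (λ u v → u * (x ^ a * v)) (^-distribˡ-+-* 2 a a) (^-distribˡ-+-* y a d) ⟩
    2 ^ a * 2 ^ a * (x ^ a * (y ^ a * y ^ d))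
      ≡⟨ regroup (2 ^ a) (x ^ a) (y ^ a) (y ^ d) ⟩
    2 ^ a * x ^ a * (2 ^ a * y ^ a) * y ^ d
      ≡⟨ cong (_* y ^ d) (cong₂ _*_ (^-distribʳ-* 2 x a) (^-distribʳ-* 2 y a)) ⟨
    (2 * x) ^ a * (2 * y) ^ a * y ^ d
      ≡⟨ cong (_* y ^ d) (^-distribʳ-* (2 * x) (2 * y) a) ⟨
    (2 * x * (2 * y)) ^ a * y ^ d
      ≤⟨ *-mono-≤ (^-monoˡ-≤ a am-gm) (^-monoˡ-≤ d (*-monoʳ-≤ 2 (m≤n+m (a + d) a))) ⟩
    (z * z) ^ a * z ^ d
      ≡⟨ cong (_* z ^ d) (^-distribʳ-* z z a) ⟩
    z ^ a * z ^ a * z ^ d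
      ≡⟨ *-assoc (z ^ a) (z ^ a) (z ^ d) ⟩
    z ^ a * (z ^ a * z ^ d)
      ≡⟨ cong (z ^ a *_) (^-distribˡ-+-* z a d) ⟨
    z ^ a * z ^ (a + d)
      ≡⟨ ^-distribˡ-+-* z a (a + d) ⟨
    z ^ (a + (a + d)) ∎
    where
    open ≤-Reasoning
    x = 2 * a
    y = 2 * (a + d)
    z = 2 * (a + (a + d))
    regroup : ∀ t u v w → t * t * (u * (v * w)) ≡ t * u * (t * v) * w
    regroup = solve-∀
    square : ∀ a d → 2 * (a + (a + d)) * (2 * (a + (a + d))) ≡
      2 * (2 * a) * (2 * (2 * (a + d))) + 4 * (d * d)
    square = solve-∀
    am-gm : 2 * x * (2 * y) ≤ z * z
    am-gm = ≤-trans (m≤m+n _ (4 * (d * d))) (≤-reflexive (sym (square a d)))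

-- The recursion for two subproblems of sizes a and b, to each of which p pairs of
-- level-0 values contribute one vertex per pair.
spanBound-step : ∀ {p a b} → p ≤ a → p ≤ b →
  2 ^ (p + p) * (spanBound a * spanBound b) ≤ spanBound (a + b)
spanBound-step {p} {a} {b} p≤a p≤b with ≤-total a b
... | inj₁ a≤b with m≤n⇒∃[o]m+o≡n a≤b
...   | d , refl = spanBound-step-≤ p a d p≤a
spanBound-step {p} {a} {b} p≤a p≤b | inj₂ b≤a with m≤n⇒∃[o]m+o≡n b≤a
...   | d , refl = subst₂ _≤_
  (cong (2 ^ (p + p) *_) (*-comm (spanBound b) (spanBound a)))
  (cong spanBound (+-comm b a))
  (spanBound-step-≤ p b d p≤b)

spanBound-+ : ∀ a b → spanBound a * spanBound b ≤ spanBound (a + b)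
spanBound-+ a b = ≤-trans (≤-reflexive (sym (*-identityˡ _))) (spanBound-step {0} {a} {b} z≤n z≤n)

2^n≤spanBound : ∀ n → 2 ^ n ≤ spanBound n
2^n≤spanBound zero      = ≤-refl
2^n≤spanBound n@(suc _) = ^-monoˡ-≤ n (*-monoʳ-≤ 2 (s≤s z≤n))

spanBound-mono : ∀ {a b} → a ≤ b → spanBound a ≤ spanBound b
spanBound-mono {a} a≤b with m≤n⇒∃[o]m+o≡n a≤b
... | d , refl = begin
  spanBound a                 ≡⟨ *-identityʳ _ ⟨
  spanBound a * 1             ≤⟨ *-monoʳ-≤ (spanBound a)
                                   (≤-trans (m^n>0 2 d) (2^n≤spanBound d)) ⟩
  spanBound a * spanBound d   ≤⟨ spanBound-+ a d ⟩
  spanBound (a + d)           ∎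
  where open ≤-Reasoning

-- The induction step of the span bound.  Of the given vertices, x₀ and x₁ are the
-- level-0 vertices whose lowest index bit is 0 and 1, and a and b lie above level 0
-- in the two halves.  From level 0, at most x₀ ⊓ x₁ level-1 vertices become derivable
-- in each half.
spanBound-level : ∀ x₀ x₁ a b →
  let p = x₀ ⊓ x₁ in
  2 ^ (x₀ + x₁) * (spanBound (p + a) * spanBound (p + b)) ≤ spanBound (x₀ + x₁ + (a + b))
spanBound-level x₀ x₁ a b with m≤n⇒∃[o]m+o≡n (m⊓n≤m x₀ x₁) | m≤n⇒∃[o]m+o≡n (m⊓n≤n x₀ x₁)
... | d₀ , eq₀ | d₁ , eq₁ = begin
  2 ^ (x₀ + x₁) * (spanBound (p + a) * spanBound (p + b))
    ≡⟨ cong (λ e → 2 ^ e * (spanBound (p + a) * spanBound (p + b)))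
         (trans (sym (cong₂ _+_ eq₀ eq₁)) (swap p d₀ d₁)) ⟩
  2 ^ (d₀ + d₁ + (p + p)) * (spanBound (p + a) * spanBound (p + b))
    ≡⟨ cong (_* (spanBound (p + a) * spanBound (p + b))) (^-distribˡ-+-* 2 (d₀ + d₁) (p + p)) ⟩
  2 ^ (d₀ + d₁) * 2 ^ (p + p) * (spanBound (p + a) * spanBound (p + b))
    ≡⟨ *-assoc (2 ^ (d₀ + d₁)) (2 ^ (p + p)) _ ⟩
  2 ^ (d₀ + d₁) * (2 ^ (p + p) * (spanBound (p + a) * spanBound (p + b)))
    ≤⟨ *-mono-≤ (2^n≤spanBound (d₀ + d₁)) (spanBound-step (m≤m+n p a) (m≤m+n p b)) ⟩
  spanBound (d₀ + d₁) * spanBound (p + a + (p + b))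
    ≤⟨ spanBound-+ (d₀ + d₁) (p + a + (p + b)) ⟩
  spanBound (d₀ + d₁ + (p + a + (p + b)))
    ≡⟨ cong spanBound (trans (total p d₀ d₁ a b) (cong (_+ (a + b)) (cong₂ _+_ eq₀ eq₁))) ⟩
  spanBound (x₀ + x₁ + (a + b)) ∎
  where
  open ≤-Reasoning
  p = x₀ ⊓ x₁
  swap : ∀ p d e → p + d + (p + e) ≡ d + e + (p + p)
  swap = solve-∀
  total : ∀ p d e a b → d + e + (p + a + (p + b)) ≡ p + d + (p + e) + (a + b)
  total = solve-∀

-- Derivable vertices and span

-- The vertices that can be computed from the values in D when every value is kept.
-- Inputs are derivable only if they lie in D.
data Derivable (G : DAG) (D : List (DAG.Vertex G)) (v : DAG.Vertex G) : Set where
  given  : v ∈ D → Derivable G D v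
  derive : ¬ DAG.Input G v → (∀ {u} → u ∈ DAG.preds G v → Derivable G D u) →
           Derivable G D v

Derivable-bind : ∀ {G D D′ v} → (∀ {u} → u ∈ D → Derivable G D′ u) →
  Derivable G D v → Derivable G D′ v
Derivable-bind f (given v∈D)  = f v∈D
Derivable-bind f (derive i p) = derive i λ u∈ → Derivable-bind f (p u∈)

Derivable-input : ∀ {G D v} → DAG.Input G v → Derivable G D v → v ∈ D
Derivable-input i (given v∈D)   = v∈D
Derivable-input i (derive ¬i _) = contradiction i ¬i

-- Any s vertices have at most s log (2 s) derivable vertices.  Finite sets are
-- bounded by exhibiting a list that covers them, possibly with repetitions; this
-- needs neither decidability nor a count of distinct elements.
BoundedSpan : DAG → Set
BoundedSpan G = ∀ D → ∃[ L ]
  (2 ^ length L ≤ spanBound (length D) × (∀ {v} → Derivable G D v → v ∈ L))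

∈-mapMaybe : ∀ {A B : Set} (f : A → Maybe B) {x y xs} →
  x ∈ xs → f x ≡ just y → y ∈ mapMaybe f xs
∈-mapMaybe f {xs = x ∷ xs} (here refl) eq rewrite eq = here refl
∈-mapMaybe f {xs = x ∷ xs} (there x∈) eq with f x
... | just _  = there (∈-mapMaybe f x∈ eq)
... | nothing = ∈-mapMaybe f x∈ eq

2^length-++ : ∀ {A : Set} (xs ys : List A) {a b} →
  2 ^ length xs ≤ a → 2 ^ length ys ≤ b → 2 ^ length (xs ++ ys) ≤ a * b
2^length-++ xs ys {a} {b} p q = begin
  2 ^ length (xs ++ ys)           ≡⟨ cong (2 ^_) (length-++ xs) ⟩
  2 ^ (length xs + length ys)     ≡⟨ ^-distribˡ-+-* 2 (length xs) (length ys) ⟩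
  2 ^ length xs * 2 ^ length ys   ≤⟨ *-mono-≤ p q ⟩
  a * b                           ∎
  where open ≤-Reasoning

2^length-map : ∀ {A B : Set} (f : A → B) xs {a} →
  2 ^ length xs ≤ a → 2 ^ length (map f xs) ≤ a
2^length-map f xs p = ≤-trans (≤-reflexive (cong (2 ^_) (length-map f xs))) p

-- The shorter of two lists covers their intersection.
shorter : ∀ {A : Set} (xs ys : List A) →
  ∃[ zs ] (length zs ≡ length xs ⊓ length ys × (∀ {v} → v ∈ xs → v ∈ ys → v ∈ zs))
shorter xs ys with ≤-total (length xs) (length ys)
... | inj₁ xs≤ys = xs , sym (m≤n⇒m⊓n≡m xs≤ys) , λ v∈xs _ → v∈xs
... | inj₂ ys≤xs = ys , sym (m≥n⇒m⊓n≡n ys≤xs) , λ _ v∈ys → v∈ys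

-- The span of an FFT DAG

Node : ℕ → Set
Node r = DAG.Vertex (FFT r)

-- The level-0 vertices with lowest index bit c, indexed by the remaining bits.
bottom : ∀ {r} → Bool → Node (suc r) → Maybe (Vec Bool r)
bottom false (zero , false ∷ i) = just i
bottom true  (zero , true  ∷ i) = just i
bottom _     _                  = nothing

-- The half of FFT (suc r) above level 0 with lowest index bit c, as a copy of FFT r:
-- above level 1 no vertex has a predecessor that differs from it in that bit.
upper : ∀ {r} → Bool → Node (suc r) → Maybe (Node r)
upper false (suc l , false ∷ i) = just (l , i)
upper true  (suc l , true  ∷ i) = just (l , i)
upper _     _                   = nothing

bottom-zero : ∀ {r} c {i : Vec Bool r} → bottom c (zero , c ∷ i) ≡ just i
bottom-zero false = refl
bottom-zero true  = refl

upper-suc : ∀ {r} c {l} {i : Vec Bool r} → upper c (suc l , c ∷ i) ≡ just (l , i)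
upper-suc false = refl
upper-suc true  = refl

length-parts : ∀ {r} (D : List (Node (suc r))) → length D ≡
  length (mapMaybe (bottom false) D) + length (mapMaybe (bottom true) D) +
  (length (mapMaybe (upper false) D) + length (mapMaybe (upper true) D))
length-parts [] = refl
length-parts (v ∷ D) = add v (length-parts D)
  where
  x₀ = length (mapMaybe (bottom false) D)
  x₁ = length (mapMaybe (bottom true) D)
  y₀ = length (mapMaybe (upper false) D)
  y₁ = length (mapMaybe (upper true) D)
  add : ∀ v → length D ≡ x₀ + x₁ + (y₀ + y₁) → suc (length D) ≡
    length (mapMaybe (bottom false) (v ∷ D)) + length (mapMaybe (bottom true) (v ∷ D)) +
    (length (mapMaybe (upper false) (v ∷ D)) + length (mapMaybe (upper true) (v ∷ D)))
  add (zero  , false ∷ i) eq = cong suc eq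
  add (zero  , true  ∷ i) eq = trans (cong suc eq) (cong (_+ (y₀ + y₁)) (sym (+-suc x₀ x₁)))
  add (suc l , false ∷ i) eq = trans (cong suc eq) (sym (+-suc (x₀ + x₁) (y₀ + y₁)))
  add (suc l , true  ∷ i) eq = trans (cong suc eq)
    (trans (sym (+-suc (x₀ + x₁) (y₀ + y₁))) (cong (x₀ + x₁ +_) (sym (+-suc y₀ y₁))))

FFT-boundedSpan : ∀ r → BoundedSpan (FFT r)
FFT-boundedSpan zero D = D , 2^n≤spanBound (length D) , λ
  { (given v∈D)                  → v∈D
  ; {zero , []} (derive ¬i _)    → contradiction refl ¬i }
FFT-boundedSpan (suc r) D = L , bound , covers
  where
  X : Bool → List (Vec Bool r)
  X c = mapMaybe (bottom c) D
  Y : Bool → List (Node r)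
  Y c = mapMaybe (upper c) D
  common = shorter (X false) (X true)
  P = proj₁ common

  -- P covers the level-1 vertices that are derived from level 0.
  D′ : Bool → List (Node r)
  D′ c = map (zero ,_) P ++ Y c

  length-D′ : ∀ c → length (D′ c) ≡ length (X false) ⊓ length (X true) + length (Y c)
  length-D′ c = trans (length-++ (map (zero ,_) P))
    (cong (_+ length (Y c)) (trans (length-map (zero ,_) P) (proj₁ (proj₂ common))))

  embed : Bool → Node r → Node (suc r)
  embed c (l , i) = suc l , c ∷ i

  L′ : Bool → List (Node r)
  L′ c = proj₁ (FFT-boundedSpan r (D′ c))

  L₀ : Bool → List (Node (suc r))
  L₀ c = map (λ i → zero , c ∷ i) (X c)

  L₁ : Bool → List (Node (suc r))
  L₁ c = map (embed c) (L′ c)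

  L = (L₀ false ++ L₀ true) ++ (L₁ false ++ L₁ true)

  given₀ : ∀ {c i} → Derivable (FFT (suc r)) D (zero , c ∷ i) → i ∈ X c
  given₀ {c} d = ∈-mapMaybe (bottom c) (Derivable-input refl d) (bottom-zero c)

  -- A derived level-1 vertex has both its level-0 predecessors in D and thus comes
  -- from P; at higher levels the two DAGs have the same predecessors.
  derivable′ : ∀ {c l i} → Derivable (FFT (suc r)) D (suc l , c ∷ i) →
    Derivable (FFT r) (D′ c) (l , i)
  derivable′ {c} (given v∈D) =
    given (∈-++⁺ʳ (map (zero ,_) P) (∈-mapMaybe (upper c) v∈D (upper-suc c)))
  derivable′ {false} {zero} (derive _ p) = given (∈-++⁺ˡ (∈-map⁺ (zero ,_)
    (proj₂ (proj₂ common) (given₀ (p (here refl))) (given₀ (p (there (here refl)))))))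
  derivable′ {true} {zero} (derive _ p) = given (∈-++⁺ˡ (∈-map⁺ (zero ,_)
    (proj₂ (proj₂ common) (given₀ (p (there (here refl)))) (given₀ (p (here refl))))))
  derivable′ {c} {suc l} (derive _ p) = derive (λ ()) λ
    { (here refl)         → derivable′ (p (here refl))
    ; (there (here refl)) → derivable′ (p (there (here refl))) }

  in₁ : ∀ c {l i} → Derivable (FFT (suc r)) D (suc l , c ∷ i) → (suc l , c ∷ i) ∈ L₁ c
  in₁ c d = ∈-map⁺ (embed c) (proj₂ (proj₂ (FFT-boundedSpan r (D′ c))) (derivable′ d))

  in₀ : ∀ c {i} → Derivable (FFT (suc r)) D (zero , c ∷ i) → (zero , c ∷ i) ∈ L₀ c
  in₀ c d = ∈-map⁺ (λ i → zero , c ∷ i) (given₀ d)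

  covers : ∀ {v} → Derivable (FFT (suc r)) D v → v ∈ L
  covers {zero , false ∷ i}  d = ∈-++⁺ˡ (∈-++⁺ˡ (in₀ false d))
  covers {zero , true ∷ i}   d = ∈-++⁺ˡ (∈-++⁺ʳ (L₀ false) (in₀ true d))
  covers {suc l , false ∷ i} d = ∈-++⁺ʳ (L₀ false ++ L₀ true) (∈-++⁺ˡ (in₁ false d))
  covers {suc l , true ∷ i}  d = ∈-++⁺ʳ (L₀ false ++ L₀ true) (∈-++⁺ʳ (L₁ false) (in₁ true d))

  bound₁ : ∀ c → 2 ^ length (L₁ c) ≤ spanBound (length (X false) ⊓ length (X true) + length (Y c))
  bound₁ c = ≤-trans
    (2^length-map (embed c) (L′ c) (proj₁ (proj₂ (FFT-boundedSpan r (D′ c)))))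
    (≤-reflexive (cong spanBound (length-D′ c)))

  length-L₀ : length (L₀ false ++ L₀ true) ≡ length (X false) + length (X true)
  length-L₀ = trans (length-++ (L₀ false))
    (cong₂ _+_ (length-map _ (X false)) (length-map _ (X true)))

  bound : 2 ^ length L ≤ spanBound (length D)
  bound = ≤-trans
    (2^length-++ (L₀ false ++ L₀ true) _
      (≤-reflexive (cong (2 ^_) length-L₀))
      (2^length-++ (L₁ false) (L₁ true) (bound₁ false) (bound₁ true)))
    (≤-trans (spanBound-level (length (X false)) (length (X true)) (length (Y false)) (length (Y true)))
      (≤-reflexive (cong spanBound (sym (length-parts D)))))

module _ {G : DAG} (spanG : BoundedSpan G) where
  open DAG G

  copies-boundedSpan : ∀ k → BoundedSpan (copies k G)
  copies-boundedSpan zero    D =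
    [] , ≤-trans (m^n>0 2 (length D)) (2^n≤spanBound (length D)) , λ { {() , _} }
  copies-boundedSpan (suc k) D = L , bound , covers
    where
    first : Fin (suc k) × Vertex → Maybe Vertex
    first (zero  , v) = just v
    first (suc _ , _) = nothing

    rest : Fin (suc k) × Vertex → Maybe (Fin k × Vertex)
    rest (zero  , _) = nothing
    rest (suc j , v) = just (j , v)

    length-parts′ : ∀ D → length D ≡ length (mapMaybe first D) + length (mapMaybe rest D)
    length-parts′ []                = refl
    length-parts′ ((zero  , _) ∷ D) = cong suc (length-parts′ D)
    length-parts′ ((suc _ , _) ∷ D) = trans (cong suc (length-parts′ D)) (sym (+-suc _ _))

    embed : Fin k × Vertex → Fin (suc k) × Vertex
    embed (j , v) = suc j , v

    span₀ = spanG (mapMaybe first D)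
    span₁ = copies-boundedSpan k (mapMaybe rest D)

    L = map (zero ,_) (proj₁ span₀) ++ map embed (proj₁ span₁)

    derivable₀ : ∀ {v} → Derivable (copies (suc k) G) D (zero , v) →
      Derivable G (mapMaybe first D) v
    derivable₀ (given v∈D)   = given (∈-mapMaybe first v∈D refl)
    derivable₀ (derive ¬i p) = derive (λ eq → ¬i (cong (map (zero ,_)) eq))
      λ u∈ → derivable₀ (p (∈-map⁺ (zero ,_) u∈))

    derivable₁ : ∀ {j v} → Derivable (copies (suc k) G) D (suc j , v) →
      Derivable (copies k G) (mapMaybe rest D) (j , v)
    derivable₁ (given v∈D)   = given (∈-mapMaybe rest v∈D refl)
    derivable₁ {j} {v} (derive ¬i p) =
      derive (λ eq → ¬i (lift-[] (preds v) eq)) λ u∈ → lift-pred (∈-map⁻ (j ,_) u∈)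
      where
      lift-[] : ∀ us → map (j ,_) us ≡ [] → map (suc j ,_) us ≡ []
      lift-[] [] _ = refl
      lift-pred : ∀ {u} → ∃[ w ] (w ∈ preds v × u ≡ (j , w)) →
        Derivable (copies k G) (mapMaybe rest D) u
      lift-pred (w , w∈ , refl) = derivable₁ (p (∈-map⁺ (suc j ,_) w∈))

    covers : ∀ {v} → Derivable (copies (suc k) G) D v → v ∈ L
    covers {zero , v}  d = ∈-++⁺ˡ (∈-map⁺ (zero ,_) (proj₂ (proj₂ span₀) (derivable₀ d)))
    covers {suc j , v} d = ∈-++⁺ʳ (map (zero ,_) (proj₁ span₀))
      (∈-map⁺ embed (proj₂ (proj₂ span₁) (derivable₁ d)))

    bound : 2 ^ length L ≤ spanBound (length D)
    bound = ≤-trans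
      (2^length-++ (map (zero ,_) (proj₁ span₀)) _
        (2^length-map _ (proj₁ span₀) (proj₁ (proj₂ span₀)))
        (2^length-map _ (proj₁ span₁) (proj₁ (proj₂ span₁))))
      (≤-trans (spanBound-+ (length (mapMaybe first D)) (length (mapMaybe rest D)))
        (≤-reflexive (cong spanBound (sym (length-parts′ D)))))

-- Counting the vertices

Unique⇒lookup-injective : ∀ {A : Set} {xs : List A} → Unique xs →
  ∀ {i j} → lookup xs i ≡ lookup xs j → i ≡ j
Unique⇒lookup-injective (x∉ ∷ u) {zero}  {zero}  eq = refl
Unique⇒lookup-injective (x∉ ∷ u) {zero}  {suc j} eq =
  contradiction eq (All.lookup x∉ (∈-lookup j))
Unique⇒lookup-injective (x∉ ∷ u) {suc i} {zero}  eq =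
  contradiction (sym eq) (All.lookup x∉ (∈-lookup i))
Unique⇒lookup-injective (x∉ ∷ u) {suc i} {suc j} eq = cong suc (Unique⇒lookup-injective u eq)

Unique-⊆⇒length-≤ : ∀ {A : Set} {xs ys : List A} → Unique xs → xs ⊆ ys → length xs ≤ length ys
Unique-⊆⇒length-≤ {xs = xs} {ys} u xs⊆ys = injective⇒≤ {f = position} injective
  where
  position : Fin (length xs) → Fin (length ys)
  position i = index (xs⊆ys (∈-lookup i))
  injective : ∀ {i j} → position i ≡ position j → i ≡ j
  injective {i} {j} eq = Unique⇒lookup-injective u (trans (lookup-index (xs⊆ys (∈-lookup i)))
    (trans (cong (lookup ys) eq) (sym (lookup-index (xs⊆ys (∈-lookup j))))))

length-cartesianProductWith : ∀ {A B C : Set} (f : A → B → C) xs ys →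
  length (cartesianProductWith f xs ys) ≡ length xs * length ys
length-cartesianProductWith f []       ys = refl
length-cartesianProductWith f (x ∷ xs) ys = trans (length-++ (map (f x) ys))
  (cong₂ _+_ (length-map (f x) ys) (length-cartesianProductWith f xs ys))

-- All indices below 2 ^ r, in binary.
indices : ∀ r → List (Vec Bool r)
indices zero    = [] ∷ []
indices (suc r) = cartesianProductWith _∷_ (false ∷ true ∷ []) (indices r)

indices-unique : ∀ r → Unique (indices r)
indices-unique zero    = All.[] ∷ []
indices-unique (suc r) = cartesianProductWith⁺ _∷_ ∷-injective
  (((λ ()) All.∷ All.[]) ∷ (All.[] ∷ [])) (indices-unique r)

length-indices : ∀ r → length (indices r) ≡ 2 ^ r
length-indices zero    = refl
length-indices (suc r) = trans
  (length-cartesianProductWith _∷_ (false ∷ true ∷ []) (indices r))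
  (cong (2 *_) (length-indices r))

module _ (k r : ℕ) where

  open DAG (copies k (FFT r))

  -- The inputs.
  sources : List Vertex
  sources = map (λ (j , i) → j , zero , i) (cartesianProduct (allFin k) (indices r))

  -- The noninput vertices.
  operations : List Vertex
  operations = map (λ (j , l , i) → j , suc l , i)
    (cartesianProduct (allFin k) (cartesianProduct (allFin r) (indices r)))

  sources-unique : Unique sources
  sources-unique = map⁺ (λ { {_ , _} {_ , _} refl → refl })
    (cartesianProduct⁺ (allFin⁺ k) (indices-unique r))

  operations-unique : Unique operations
  operations-unique = map⁺ (λ { {_ , _ , _} {_ , _ , _} refl → refl })
    (cartesianProduct⁺ (allFin⁺ k) (cartesianProduct⁺ (allFin⁺ r) (indices-unique r)))

  length-sources : length sources ≡ k * 2 ^ r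
  length-sources = trans (length-map _ (cartesianProduct (allFin k) (indices r)))
    (trans (length-cartesianProductWith _,_ (allFin k) (indices r))
      (cong₂ _*_ (length-tabulate {n = k} (λ i → i)) (length-indices r)))

  length-operations : length operations ≡ k * (r * 2 ^ r)
  length-operations = trans
    (length-map _ (cartesianProduct (allFin k) (cartesianProduct (allFin r) (indices r))))
    (trans (length-cartesianProductWith _,_ (allFin k) (cartesianProduct (allFin r) (indices r)))
      (cong₂ _*_ (length-tabulate {n = k} (λ i → i))
        (trans (length-cartesianProductWith _,_ (allFin r) (indices r))
          (cong₂ _*_ (length-tabulate {n = r} (λ i → i)) (length-indices r)))))

-- Runs and their cache misses

module _ {G : DAG} where
  open DAG G

  -- Derivable as the result of an evaluation, even if the vertex itself lies in D;
  -- thus any inputs among the predecessors lie in D.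
  Computed : List Vertex → Vertex → Set
  Computed D v = ¬ Input v × (∀ {u} → u ∈ preds v → Derivable G D u)

  Computed⇒Derivable : ∀ {D v} → Computed D v → Derivable G D v
  Computed⇒Derivable (¬i , p) = derive ¬i p

  module _ {M B : ℕ} where
    open Cache M B G

    -- All values evaluated in a run are computed from the values loaded by its misses
    -- and a set D from which the initial cache C is derivable.
    dominate : ∀ {C E q C′ E′} → Run (C , E) q (C′ , E′) →
      ∀ D → (∀ {v} → v ∈ C → Derivable G D v) →
      ∃[ loads ] (length loads ≤ q * B × (∀ {v} → v ∈ E′ → v ∈ E ⊎ Computed (loads ++ D) v))
    dominate stop D C-derivable = [] , z≤n , inj₁
    dominate {C} {E} {q = suc q} {E′ = E′} (miss {C′ = C₁} block block≤B _ C₁⊆ _ run) D C-derivable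
      = let loads , loads≤ , new = dominate run (block ++ D) C₁-derivable in
        loads ++ block
      , bound loads loads≤
      , λ v∈ → map₂ (subst (λ D′ → Computed D′ _) (sym (++-assoc loads block D))) (new v∈)
      where
      C₁-derivable : ∀ {v} → v ∈ C₁ → Derivable G (block ++ D) v
      C₁-derivable v∈ with ∈-++⁻ block (C₁⊆ v∈)
      ... | inj₁ v∈block = given (∈-++⁺ˡ v∈block)
      ... | inj₂ v∈C     = Derivable-bind (λ u∈ → given (∈-++⁺ʳ block u∈)) (C-derivable v∈C)
      bound : ∀ loads → length loads ≤ q * B → length (loads ++ block) ≤ B + q * B
      bound loads loads≤ = begin
        length (loads ++ block)       ≡⟨ length-++ loads ⟩
        length loads + length block   ≤⟨ +-mono-≤ loads≤ block≤B ⟩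
        q * B + B                     ≡⟨ +-comm (q * B) B ⟩
        B + q * B                     ∎
        where open ≤-Reasoning
    dominate {C} {E} {E′ = E′} (eval {C′ = C₁} v ¬i _ preds∈C C₁⊆ _ run) D C-derivable
      = let loads , loads≤ , new = dominate run D C₁-derivable in
        loads , loads≤ , λ u∈ → split loads (new u∈)
      where
      computed : Computed D v
      computed = ¬i , λ u∈ → C-derivable (All.lookup preds∈C u∈)
      C₁-derivable : ∀ {u} → u ∈ C₁ → Derivable G D u
      C₁-derivable u∈ with C₁⊆ u∈
      ... | here refl  = Computed⇒Derivable computed
      ... | there u∈C  = C-derivable u∈C
      split : ∀ loads {u} → u ∈ v ∷ E ⊎ Computed (loads ++ D) u → u ∈ E ⊎ Computed (loads ++ D) u
      split loads (inj₁ (here refl)) = inj₂ (¬i , λ u∈ →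
        Derivable-bind (λ w∈ → given (∈-++⁺ʳ loads w∈)) (proj₂ computed u∈))
      split loads (inj₁ (there u∈))  = inj₁ u∈
      split loads (inj₂ c)           = inj₂ c

    -- A run can be split right after its m-th miss.
    cut : ∀ m {k s s′} → length (cache s) ≤ M → Run s (m + k) s′ →
      ∃[ s₁ ] (length (cache s₁) ≤ M × Run s m s₁ × Run s₁ k s′)
    cut zero fits run = _ , fits , stop , run
    cut (suc m) fits (miss block b a sub fits′ run)
      with s₁ , fits₁ , r₁ , r₂ ← cut m fits′ run
      = s₁ , fits₁ , miss block b a sub fits′ r₁ , r₂
    cut (suc m) fits (eval v i n p sub fits′ run)
      with s₁ , fits₁ , r₁ , r₂ ← cut (suc m) fits′ run
      = s₁ , fits₁ , eval v i n p sub fits′ r₁ , r₂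

    module _ (bounded : BoundedSpan G) (m a : ℕ) (span≤a : spanBound (M + m * B) ≤ a) where

      -- A run of at most m misses evaluates at most log a vertices.
      segment : ∀ {s q s′} → q ≤ m → length (cache s) ≤ M → Run s q s′ →
        ∃[ L ] (2 ^ length L ≤ a × (∀ {v} → v ∈ evaluated s′ → v ∈ evaluated s ⊎ v ∈ L))
      segment {C , E} {q} q≤m fits run
        with loads , loads≤ , new ← dominate run C given
        with L , L≤ , covers ← bounded (loads ++ C)
        = L
        , ≤-trans L≤ (≤-trans (spanBound-mono D≤) span≤a)
        , λ v∈ → map₂ (λ c → covers (Computed⇒Derivable c)) (new v∈)
        where
        D≤ : length (loads ++ C) ≤ M + m * B
        D≤ = begin
          length (loads ++ C)        ≡⟨ length-++ loads ⟩
          length loads + length C    ≤⟨ +-mono-≤ (≤-trans loads≤ (*-monoˡ-≤ B q≤m)) fits ⟩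
          m * B + M                  ≡⟨ +-comm (m * B) M ⟩
          M + m * B                  ∎
          where open ≤-Reasoning

      -- A run is cut into k stretches of m misses and a last one of ρ misses.
      segments : ∀ k {ρ s s′} → ρ ≤ m → length (cache s) ≤ M → Run s (k * m + ρ) s′ →
        ∃[ L ] (2 ^ length L ≤ a ^ suc k × (∀ {v} → v ∈ evaluated s′ → v ∈ evaluated s ⊎ v ∈ L))
      segments zero ρ≤m fits run
        with L , L≤ , covers ← segment ρ≤m fits run
        = L , ≤-trans L≤ (≤-reflexive (sym (*-identityʳ a))) , covers
      segments (suc k) {ρ} {s} {s′} ρ≤m fits run
        with s₁ , fits₁ , r₁ , r₂ ← cut m {k * m + ρ} fits
          (subst (λ q → Run s q s′) (+-assoc m (k * m) ρ) run)
        with L₁ , L₁≤ , covers₁ ← segment ≤-refl fits r₁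
        with L₂ , L₂≤ , covers₂ ← segments k ρ≤m fits₁ r₂
        = L₁ ++ L₂ , 2^length-++ L₁ L₂ L₁≤ L₂≤ , λ v∈ → merge (covers₂ v∈) covers₁
        where
        merge : ∀ {v} → v ∈ evaluated s₁ ⊎ v ∈ L₂ →
          (v ∈ evaluated s₁ → v ∈ evaluated s ⊎ v ∈ L₁) →
          v ∈ evaluated s ⊎ v ∈ L₁ ++ L₂
        merge (inj₁ v∈) f = map₂ ∈-++⁺ˡ (f v∈)
        merge (inj₂ v∈) f = inj₂ (∈-++⁺ʳ L₁ v∈)

module _ {M B k r : ℕ} where
  open Cache M B (copies k (FFT r))

  operations-bound : ∀ {C₀ a} m .{{_ : NonZero m}} → spanBound (M + m * B) ≤ a → length C₀ ≤ M →
    (e : Evaluation C₀) → let q = Evaluation.misses e in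
    2 ^ (k * (r * 2 ^ r)) ≤ a ^ suc (q / m)
  operations-bound {C₀} {a} m span≤a fits e
    using q ← Evaluation.misses e
    with L , L≤ , covers ← segments (copies-boundedSpan (FFT-boundedSpan r) k) m a span≤a
      (q / m) (<⇒≤ (m%n<n q m)) fits
      (subst (λ q → Run (C₀ , []) q (Evaluation.final e))
        (trans (m≡m%n+[m/n]*n q m) (+-comm (q % m) (q / m * m)))
        (Evaluation.run e))
    = ≤-trans (^-monoʳ-≤ 2 (≤-trans (≤-reflexive (sym (length-operations k r)))
        (Unique-⊆⇒length-≤ (operations-unique k r) operations⊆L))) L≤
    where
    open Evaluation e
    operations⊆L : operations k r ⊆ L
    operations⊆L v∈
      with (j , l , i) , _ , refl ← ∈-map⁻ _ v∈
      with covers (complete (j , suc l , i) (λ ()))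
    ... | inj₂ v∈L = v∈L

module _ {M B k r : ℕ} where
  open Cache M B (copies k (FFT (suc r)))

  -- Every input is a predecessor of a level-1 vertex, so it is loaded at least once.
  -- A DAG with a single level has nothing to evaluate, hence the length 2 ^ suc r.
  inputs-bound : (e : Evaluation []) → k * 2 ^ suc r ≤ Evaluation.misses e * B
  inputs-bound e with loads , loads≤ , new ← dominate (Evaluation.run e) [] (λ ())
    = begin
      k * 2 ^ suc r              ≡⟨ length-sources k (suc r) ⟨
      length (sources k (suc r)) ≤⟨ Unique-⊆⇒length-≤ (sources-unique k (suc r)) sources⊆ ⟩
      length loads               ≤⟨ loads≤ ⟩
      misses * B                 ∎
    where
    open ≤-Reasoning
    open Evaluation e
    sources⊆ : sources k (suc r) ⊆ loads
    sources⊆ v∈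
      with (j , i) , _ , refl ← ∈-map⁻ _ v∈
      with new (complete (j , suc zero , i) (λ ()))
    ... | inj₂ (_ , p) =
      subst (_ ∈_) (++-identityʳ loads) (Derivable-input refl (p (here refl)))

-- The lower bound for one phase

n≤2^n : ∀ n → n ≤ 2 ^ n
n≤2^n zero    = z≤n
n≤2^n (suc n) = +-mono-≤ (m^n>0 2 n)
  (≤-trans (n≤2^n n) (≤-reflexive (sym (+-identityʳ (2 ^ n)))))

-- For s = (2 + K) M we have log (2 s) ≤ (5 + 2 K) log M when M ≥ 2, so s log (2 s) is
-- at most spanConstant K times M log M.
spanConstant : ℕ → ℕ
spanConstant K = (5 + 2 * K) * (2 + K)

spanBound-≤-^ : ∀ {M} K → 2 ≤ M → spanBound ((2 + K) * M) ≤ M ^ (spanConstant K * M)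
spanBound-≤-^ {M} K 2≤M = begin
  (2 * ((2 + K) * M)) ^ ((2 + K) * M)       ≤⟨ ^-monoˡ-≤ ((2 + K) * M) base ⟩
  (M ^ (5 + 2 * K)) ^ ((2 + K) * M)         ≡⟨ ^-*-assoc M (5 + 2 * K) ((2 + K) * M) ⟩
  M ^ ((5 + 2 * K) * ((2 + K) * M))         ≡⟨ cong (M ^_) (*-assoc (5 + 2 * K) (2 + K) M) ⟨
  M ^ (spanConstant K * M)                  ∎
  where
  open ≤-Reasoning
  base : 2 * ((2 + K) * M) ≤ M ^ (5 + 2 * K)
  base = begin
    2 * ((2 + K) * M)       ≡⟨ factor K M ⟩
    M * (4 + 2 * K)         ≤⟨ *-monoʳ-≤ M (n≤2^n (4 + 2 * K)) ⟩
    M * 2 ^ (4 + 2 * K)     ≤⟨ *-monoʳ-≤ M (^-monoˡ-≤ (4 + 2 * K) 2≤M) ⟩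
    M * M ^ (4 + 2 * K)     ∎
    where
    factor : ∀ K M → 2 * ((2 + K) * M) ≡ M * (4 + 2 * K)
    factor = solve-∀

module _ {M B K : ℕ} (2≤M : 2 ≤ M) (1≤B : 1 ≤ B) (B²≤KM : B * B ≤ K * M) where

  private instance
    M≢0 : NonZero M
    M≢0 = >-nonZero (≤-trans (s≤s z≤n) 2≤M)
    B≢0 : NonZero B
    B≢0 = >-nonZero 1≤B

  -- A phase with q misses evaluates O((M + q B) log M) vertices.
  phase-bound : ∀ {k r C₀} → length C₀ ≤ M → (e : Cache.Evaluation M B (copies k (FFT r)) C₀) →
    2 ^ (k * (r * 2 ^ r)) ≤ M ^ (spanConstant K * (M + Cache.Evaluation.misses e * B))
  phase-bound {k} {r} fits e = begin
    2 ^ (k * (r * 2 ^ r))                    ≤⟨ operations-bound {k = k} {r} m span≤ fits e ⟩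
    (M ^ (c * M)) ^ suc (q / m)              ≡⟨ ^-*-assoc M (c * M) (suc (q / m)) ⟩
    M ^ (c * M * suc (q / m))                ≤⟨ ^-monoʳ-≤ M exponent ⟩
    M ^ (c * (M + q * B))                    ∎
    where
    open ≤-Reasoning
    q = Cache.Evaluation.misses e
    c = spanConstant K
    -- m B is the least multiple of B above M, so M < m B ≤ M + B.
    m = suc (M / B)

    M≤mB : M ≤ m * B
    M≤mB = begin
      M                      ≡⟨ m≡m%n+[m/n]*n M B ⟩
      M % B + M / B * B      ≤⟨ +-monoˡ-≤ (M / B * B) (<⇒≤ (m%n<n M B)) ⟩
      m * B                  ∎

    span≤ : spanBound (M + m * B) ≤ M ^ (c * M)
    span≤ = ≤-trans (spanBound-mono size≤) (spanBound-≤-^ K 2≤M)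
      where
      total : ∀ K M → M + (K * M + M) ≡ (2 + K) * M
      total = solve-∀
      size≤ : M + m * B ≤ (2 + K) * M
      -- B ≤ B ² ≤ K M.
      size≤ = begin
        M + (B + M / B * B)  ≤⟨ +-monoʳ-≤ M (+-mono-≤ (≤-trans (m≤m*n B B) B²≤KM) (m/n*n≤m M B)) ⟩
        M + (K * M + M)      ≡⟨ total K M ⟩
        (2 + K) * M          ∎

    exponent : c * M * suc (q / m) ≤ c * (M + q * B)
    exponent = begin
      c * M * suc (q / m)          ≡⟨ *-assoc c M (suc (q / m)) ⟩
      c * (M * suc (q / m))        ≡⟨ cong (c *_) (*-suc M (q / m)) ⟩
      c * (M + M * (q / m))        ≤⟨ *-monoʳ-≤ c (+-monoʳ-≤ M (*-monoˡ-≤ (q / m) M≤mB)) ⟩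
      c * (M + m * B * (q / m))    ≡⟨ cong (λ x → c * (M + x)) (rotate m B (q / m)) ⟩
      c * (M + q / m * m * B)      ≤⟨ *-monoʳ-≤ c (+-monoʳ-≤ M (*-monoˡ-≤ B (m/n*n≤m q m))) ⟩
      c * (M + q * B)              ∎
      where
      rotate : ∀ x y z → x * y * z ≡ z * x * y
      rotate = solve-∀

-- The two local phases on one processor

-- Here n stands for N / p, and Q for the number of misses.  For M ≤ n the bound on
-- N ^ n is used; for n ≤ M it is not needed, because N = n p ≤ M ².
combine : ∀ {M N n p Q B} c → 2 ≤ M → N ≡ n * p → p ≤ n → n ≤ Q * B →
  N ^ n ≤ M ^ (c * (M + M + Q * B)) →
  M ^ N * N ^ N ≤ M ^ ((3 + 3 * c) * Q * (p * B))
combine {M} {N} {n} {p} {Q} {B} c 2≤M N≡np p≤n n≤QB N^n≤ = begin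
  M ^ N * N ^ N                     ≡⟨ cong (λ e → M ^ e * N ^ e) N≡np ⟩
  M ^ (n * p) * N ^ (n * p)         ≡⟨ cong₂ _*_ (^-*-assoc M n p) (^-*-assoc N n p) ⟨
  (M ^ n) ^ p * (N ^ n) ^ p         ≡⟨ ^-distribʳ-* (M ^ n) (N ^ n) p ⟨
  (M ^ n * N ^ n) ^ p               ≤⟨ ^-monoˡ-≤ p (per-processor (≤-total M n)) ⟩
  (M ^ ((3 + 3 * c) * x)) ^ p       ≡⟨ ^-*-assoc M ((3 + 3 * c) * x) p ⟩
  M ^ ((3 + 3 * c) * (Q * B) * p)   ≡⟨ cong (M ^_) (rotate (3 + 3 * c) Q B p) ⟩
  M ^ ((3 + 3 * c) * Q * (p * B))   ∎
  where
  open ≤-Reasoning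
  x = Q * B
  instance
    M≢0 : NonZero M
    M≢0 = >-nonZero (≤-trans (s≤s z≤n) 2≤M)

  rotate : ∀ a b c d → a * (b * c) * d ≡ a * b * (d * c)
  rotate = solve-∀

  per-processor : M ≤ n ⊎ n ≤ M → M ^ n * N ^ n ≤ M ^ ((3 + 3 * c) * x)
  per-processor (inj₁ M≤n) = begin
    M ^ n * N ^ n                       ≤⟨ *-mono-≤ (^-monoʳ-≤ M n≤QB) N^n≤ ⟩
    M ^ x * M ^ (c * (M + M + x))       ≡⟨ ^-distribˡ-+-* M x _ ⟨
    M ^ (x + c * (M + M + x))           ≤⟨ ^-monoʳ-≤ M (+-monoʳ-≤ x (*-monoʳ-≤ c
                                             (+-monoˡ-≤ x (+-mono-≤ M≤x M≤x)))) ⟩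
    M ^ (x + c * (x + x + x))           ≤⟨ ^-monoʳ-≤ M (m≤m+n (x + c * (x + x + x)) (x + x)) ⟩
    M ^ (x + c * (x + x + x) + (x + x)) ≡⟨ cong (M ^_) (collect c x) ⟩
    M ^ ((3 + 3 * c) * x)               ∎
    where
    M≤x = ≤-trans M≤n n≤QB
    collect : ∀ c x → x + c * (x + x + x) + (x + x) ≡ (3 + 3 * c) * x
    collect = solve-∀
  per-processor (inj₂ n≤M) = begin
    M ^ n * N ^ n                       ≤⟨ *-monoʳ-≤ (M ^ n) (^-monoˡ-≤ n N≤MM) ⟩
    M ^ n * (M ^ 2) ^ n                 ≡⟨ cong (M ^ n *_) (^-*-assoc M 2 n) ⟩
    M ^ n * M ^ (2 * n)                 ≡⟨ ^-distribˡ-+-* M n (2 * n) ⟨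
    M ^ (3 * n)                         ≤⟨ ^-monoʳ-≤ M (*-mono-≤ (m≤m+n 3 (3 * c)) n≤QB) ⟩
    M ^ ((3 + 3 * c) * x)               ∎
    where
    N≤MM : N ≤ M ^ 2
    N≤MM = begin
      N            ≡⟨ N≡np ⟩
      n * p        ≤⟨ *-mono-≤ n≤M (≤-trans p≤n n≤M) ⟩
      M * M        ≡⟨ cong (M *_) (*-identityʳ M) ⟨
      M ^ 2        ∎

module _ {t K : ℕ} (P : Parameters t K) where
  open Parameters P

  private
    c = spanConstant K
    k₁ = quotient p∣N₂
    k₃ = quotient p∣N₁
    -- N / p
    n = k₁ * N₁
    instance
      p≢0 : NonZero p
      p≢0 = >-nonZero (≤-trans (s≤s z≤n) 2≤p)
      M≢0 : NonZero M
      M≢0 = >-nonZero (≤-trans (s≤s z≤n) 2≤M)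
      N₁≢0 : NonZero N₁
      N₁≢0 = subst NonZero (sym N₁≡2^r₁) (m^n≢0 2 r₁)

  N≡np : N ≡ n * p
  N≡np = trans (cong (N₁ *_) (m∣n⇒n≡quotient*m p∣N₂)) (rotate N₁ k₁ p)
    where
    rotate : ∀ x y z → x * (y * z) ≡ y * x * z
    rotate = solve-∀

  n≡k₃N₂ : n ≡ k₃ * N₂
  n≡k₃N₂ = *-cancelʳ-≡ n (k₃ * N₂) p (trans (sym N≡np)
    (trans (cong (_* N₂) (m∣n⇒n≡quotient*m p∣N₁)) (rotate k₃ p N₂)))
    where
    rotate : ∀ x y z → x * y * z ≡ x * z * y
    rotate = solve-∀

  p≤n : p ≤ n
  p≤n = ≤-trans (∣⇒≤ p∣N₁) (≤-trans (≤-reflexive (sym (*-identityˡ N₁)))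
    (*-monoˡ-≤ N₁ (≤-trans 1≤B B≤N₂/p)))

  phaseI-inputs-bound : (e : Cache.Evaluation M B dagI []) → n ≤ Cache.Evaluation.misses e * B
  phaseI-inputs-bound = bound r₁ N₁≡2^r₁
    where
    bound : ∀ r → N₁ ≡ 2 ^ r → (e : Cache.Evaluation M B (copies k₁ (FFT r)) []) →
      n ≤ Cache.Evaluation.misses e * B
    -- r₁ ≥ 1, since 2 ≤ p ≤ N₁ = 2 ^ r₁.
    bound zero    eq e =
      contradiction (≤-trans 2≤p (≤-trans (∣⇒≤ p∣N₁) (≤-reflexive eq))) λ { (s≤s ()) }
    bound (suc r) eq e = ≤-trans (≤-reflexive (cong (k₁ *_) eq)) (inputs-bound {k = k₁} {r} e)

  -- The two phases have n (r₁ + r₂) = n log N noninput vertices.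
  N^n-bound : ∀ (X : LocalExecution) → N ^ n ≤ M ^ (c * (M + M + LocalExecution.localMisses X * B))
  N^n-bound X = begin
    N ^ n
      ≡⟨ cong (_^ n) (trans (cong₂ _*_ N₁≡2^r₁ N₂≡2^r₂) (sym (^-distribˡ-+-* 2 r₁ r₂))) ⟩
    (2 ^ (r₁ + r₂)) ^ n
      ≡⟨ ^-*-assoc 2 (r₁ + r₂) n ⟩
    2 ^ ((r₁ + r₂) * n)
      ≡⟨ cong (2 ^_) exponent ⟩
    2 ^ (k₁ * (r₁ * 2 ^ r₁) + k₃ * (r₂ * 2 ^ r₂))
      ≡⟨ ^-distribˡ-+-* 2 (k₁ * (r₁ * 2 ^ r₁)) _ ⟩
    2 ^ (k₁ * (r₁ * 2 ^ r₁)) * 2 ^ (k₃ * (r₂ * 2 ^ r₂))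
      ≤⟨ *-mono-≤ (phase-bound {K = K} 2≤M 1≤B B²≤KM {k = k₁} {r₁} z≤n phaseI)
                  (phase-bound {K = K} 2≤M 1≤B B²≤KM {k = k₃} {r₂} length-cacheIII≤M phaseIII) ⟩
    M ^ (c * (M + missesI * B)) * M ^ (c * (M + missesIII * B))
      ≡⟨ ^-distribˡ-+-* M (c * (M + missesI * B)) _ ⟨
    M ^ (c * (M + missesI * B) + c * (M + missesIII * B))
      ≡⟨ cong (M ^_) (collect c M missesI missesIII B) ⟩
    M ^ (c * (M + M + localMisses * B)) ∎
    where
    open ≤-Reasoning
    open LocalExecution X
    collect : ∀ c M x y B → c * (M + x * B) + c * (M + y * B) ≡ c * (M + M + (x + y) * B)
    collect = solve-∀
    swap : ∀ x y z → x * (y * z) ≡ y * (x * z)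
    swap = solve-∀
    exponent : (r₁ + r₂) * n ≡ k₁ * (r₁ * 2 ^ r₁) + k₃ * (r₂ * 2 ^ r₂)
    exponent = trans (*-distribʳ-+ n r₁ r₂) (cong₂ _+_
      (trans (swap r₁ k₁ N₁) (cong (λ x → k₁ * (r₁ * x)) N₁≡2^r₁))
      (trans (cong (r₂ *_) n≡k₃N₂) (trans (swap r₂ k₃ N₂) (cong (λ x → k₃ * (r₂ * x)) N₂≡2^r₂))))

  lower-bound : ∀ (X : LocalExecution) {Q} →
    LocalExecution.localMisses X ≤ Q → LowerBound (3 + 3 * c) Q
  lower-bound X {Q} local≤Q = combine {Q = Q} {B} c 2≤M N≡np p≤n
    (≤-trans (phaseI-inputs-bound phaseI) (*-monoˡ-≤ B (≤-trans (m≤m+n missesI missesIII) local≤Q)))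
    (≤-trans (N^n-bound X) (^-monoʳ-≤ M (*-monoʳ-≤ c (+-monoʳ-≤ (M + M) (*-monoˡ-≤ B local≤Q)))))
    where open LocalExecution X

  ≤-maximum : ∀ (f : Fin p → ℕ) (i : Fin p) → f i ≤ maximum f
  ≤-maximum = go
    where
    go : ∀ {k} (f : Fin k → ℕ) i → f i ≤ foldr _⊔_ 0 f
    go f zero    = m≤m⊔n _ _
    go f (suc i) = m≤n⇒m≤o⊔n (f zero) (go (λ j → f (suc j)) i)

proposition6 : ∀ (t K : ℕ) →
    ∃[ C ] (0 < C ×
    (∀ (P : Parameters t K) (X : Parameters.Execution P) →
    Parameters.LowerBound P C (Parameters.Qmax-local P X) ×
    Parameters.LowerBound P C (Parameters.Qmax-complete P X)))
-- A single processor yields both bounds; there is one because p ≥ 2.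
proposition6 t K = 3 + 3 * spanConstant K , s≤s z≤n , λ P X →
  let open Parameters P
      i = fromℕ< (≤-trans (s≤s z≤n) 2≤p)
      open LocalExecution (X i)
  in lower-bound P (X i) (≤-maximum P (λ j → LocalExecution.localMisses (X j)) i)
   , lower-bound P (X i) (≤-trans (+-monoˡ-≤ missesIII (m≤m+n missesI middleMisses))
       (≤-maximum P (λ j → LocalExecution.totalMisses (X j)) i))
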